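{- Let $\mathcal{R}\subseteq 2^\omega$ be the class of $m$-rigid sets. Then $\mu(\mathcal{R})=1$. Moreover, every Martin-Löf random set $A\in 2^\omega$ is $m$-rigid.
   Context: $\omega=\{0,1,2,\dots\}$; sets $A\subseteq\omega$ are identified with their characteristic functions in Cantor space $2^\omega$. For a finite binary string $\sigma$, $[\sigma]=\{X\in 2^\omega:\sigma \text{ is an initial segment of } X\}$, and $\mu$ is the fair-coin product measure on $2^\omega$, determined by $\mu([\sigma])=2^{ -|\sigma|}$. A total computable function $k:\omega\to\omega$ is an $m$-autoreduction of $A$ if for all $x$, $x\in A\iff k(x)\in A$. The set $A$ is $m$-rigid if every $m$-autoreduction $k$ of $A$ is eventually the identity, i.e. $k(x)=x$ for all but finitely many $x$. A Martin-Löf test is a sequence $(U_n)_{n\in\omega}$ of uniformly c.e. open subsets of $2^\omega$ (i.e. $U_n=\bigcup_{\sigma\in W_n}[\sigma]$ for a uniformly computably enumerable sequence $(W_n)_{n\in\omega}$ of sets of finite binary strings) such that $\mu(U_n)\le 2^{ -n}$ for all $n$. A set $X\in 2^\omega$ is Martin-Löf random if $X\notin\bigcap_n U_n$ for every Martin-Löf test $(U_n)_{n\in\omega}$. -}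

module Defs where

open import Level using (0ℓ)
open import Data.Bool.Base using (Bool; true; false)
open import Data.Fin.Base using (Fin; toℕ)
open import Data.List.Base using (List; []; _∷_; length; lookup)
open import Data.Maybe.Base using (Maybe; just; nothing)
open import Data.Nat.Base as ℕ using (ℕ; zero; suc)
open import Data.Product.Base using (∃; ∃-syntax; _×_)
open import Data.Rational.Base using (ℚ; 0ℚ; 1ℚ; ½; _+_; _-_; _≤_; _<_; +-*-rawSemiring)
open import Data.Vec.Base as Vec using (Vec)
open import Data.Vec.Relation.Binary.Pointwise.Inductive using (Pointwise)
open import Function.Bundles using (_⇔_)
open import Relation.Binary.PropositionalEquality using (_≡_)
open import Relation.Nullary.Negation.Core using (¬_)
open import Relation.Unary using (Pred; _∈_; _⊆_; ∁)

open import Algebra.Definitions.RawSemiring +-*-rawSemiring using (_^_)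

-- Kleene's μ-recursive functions; the index is the arity.
data Rec : ℕ → Set where
  zeroᶜ : ∀ {n} → Rec n
  sucᶜ  : Rec 1
  proj  : ∀ {n} → Fin n → Rec n
  comp  : ∀ {m n} → Rec m → Vec (Rec n) m → Rec n
  prec  : ∀ {n} → Rec n → Rec (2 ℕ.+ n) → Rec (1 ℕ.+ n)
  mu    : ∀ {n} → Rec (1 ℕ.+ n) → Rec n

infix 4 _⟨_⟩⇓_

data _⟨_⟩⇓_ : ∀ {n} → Rec n → Vec ℕ n → ℕ → Set where
  zero⇓ : ∀ {n} {xs : Vec ℕ n} → zeroᶜ ⟨ xs ⟩⇓ 0
  suc⇓  : ∀ {x} → sucᶜ ⟨ x Vec.∷ Vec.[] ⟩⇓ suc x
  proj⇓ : ∀ {n} {i : Fin n} {xs} → proj i ⟨ xs ⟩⇓ Vec.lookup xs i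
  comp⇓ : ∀ {m n} {f : Rec m} {gs : Vec (Rec n) m} {xs ys z} →
          Pointwise (λ g y → g ⟨ xs ⟩⇓ y) gs ys → f ⟨ ys ⟩⇓ z →
          comp f gs ⟨ xs ⟩⇓ z
  prec⇓-zero : ∀ {n} {f : Rec n} {g xs y} →
          f ⟨ xs ⟩⇓ y → prec f g ⟨ 0 Vec.∷ xs ⟩⇓ y
  prec⇓-suc  : ∀ {n} {f : Rec n} {g xs k r y} →
          prec f g ⟨ k Vec.∷ xs ⟩⇓ r → g ⟨ k Vec.∷ r Vec.∷ xs ⟩⇓ y →
          prec f g ⟨ suc k Vec.∷ xs ⟩⇓ y
  mu⇓   : ∀ {n} {f : Rec (1 ℕ.+ n)} {xs y} →
          f ⟨ y Vec.∷ xs ⟩⇓ 0 →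
          (∀ z → z ℕ.< y → ∃[ v ] f ⟨ z Vec.∷ xs ⟩⇓ suc v) →
          mu f ⟨ xs ⟩⇓ y

Computable : (ℕ → ℕ) → Set
Computable k = ∃[ f ] ∀ x → f ⟨ x Vec.∷ Vec.[] ⟩⇓ k x

String : Set
String = List Bool

bit : Bool → ℕ
bit false = 0
bit true  = 1

-- Bijective base-2 numeration, least significant digit first: a computable
-- bijection between strings and ℕ.
code : String → ℕ
code []      = 0
code (b ∷ σ) = 1 ℕ.+ bit b ℕ.+ 2 ℕ.* code σ

-- A relation on ℕ × String is c.e. iff it is the domain of a partial
-- computable function.
UniformlyCE : (ℕ → Pred String 0ℓ) → Set
UniformlyCE W =
  ∃[ f ] ∀ n σ → σ ∈ W n ⇔ (∃[ y ] f ⟨ n Vec.∷ code σ Vec.∷ Vec.[] ⟩⇓ y)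

Cantor : Set
Cantor = ℕ → Bool

[_] : String → Pred Cantor 0ℓ
[ σ ] X = ∀ (i : Fin (length σ)) → lookup σ i ≡ X (toℕ i)

⟦_⟧ : Pred String 0ℓ → Pred Cantor 0ℓ
⟦ W ⟧ X = ∃[ σ ] σ ∈ W × X ∈ [ σ ]

-- A countable, possibly finite, family of cylinders; `nothing` contributes none.
Family : Set
Family = ℕ → Maybe String

Covers : Family → Pred Cantor 0ℓ → Set
Covers w S = S ⊆ λ X → ∃[ i ] ∃[ σ ] w i ≡ just σ × X ∈ [ σ ]

weight : Maybe String → ℚ
weight nothing  = 0ℚ
weight (just σ) = ½ ^ length σ

partialSum : Family → ℕ → ℚ
partialSum w zero    = 0ℚ
partialSum w (suc n) = partialSum w n + weight (w n)

-- Total Σᵢ weight (w i) ≤ r; the terms are nonnegative.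
TotalAtMost : Family → ℚ → Set
TotalAtMost w r = ∀ n → partialSum w n ≤ r

-- The outer measure μ*(S) is the infimum of the totals of the covers of S.
-- As a real number it is given by its comparisons with rationals.
OuterMeasure≤ : Pred Cantor 0ℓ → ℚ → Set
OuterMeasure≤ S q = ∀ ε → 0ℚ < ε → ∃[ w ] Covers w S × TotalAtMost w (q + ε)

OuterMeasure≥ : Pred Cantor 0ℓ → ℚ → Set
OuterMeasure≥ S q = ∀ w → Covers w S → ∀ r → TotalAtMost w r → q ≤ r

OuterMeasure≡ : Pred Cantor 0ℓ → ℚ → Set
OuterMeasure≡ S q = OuterMeasure≤ S q × OuterMeasure≥ S q

-- Lebesgue's definition for a space of total mass 1: S is measurable iff
-- μ*(S) + μ*(∁ S) = 1, and then μ(S) = μ*(S).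
HasMeasure : Pred Cantor 0ℓ → ℚ → Set
HasMeasure S q = OuterMeasure≡ S q × OuterMeasure≡ (∁ S) (1ℚ - q)

-- Open sets are measurable, so μ(Uₙ) is the outer measure of Uₙ.
record IsMartinLöfTest (W : ℕ → Pred String 0ℓ) : Set where
  field
    uniformlyCE : UniformlyCE W
    measure≤    : ∀ n → OuterMeasure≤ ⟦ W n ⟧ (½ ^ n)

MartinLöfRandom : Cantor → Set₁
MartinLöfRandom X = ∀ W → IsMartinLöfTest W → ¬ (∀ n → X ∈ ⟦ W n ⟧)

_∈ᶜ_ : ℕ → Cantor → Set
x ∈ᶜ A = A x ≡ true

IsMAutoreduction : Cantor → (ℕ → ℕ) → Set
IsMAutoreduction A k = Computable k × (∀ x → x ∈ᶜ A ⇔ k x ∈ᶜ A)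

EventuallyIdentity : (ℕ → ℕ) → Set
EventuallyIdentity k = ∃[ N ] ∀ x → N ℕ.≤ x → k x ≡ x

MRigid : Pred Cantor 0ℓ
MRigid A = ∀ k → IsMAutoreduction A k → EventuallyIdentity k

{-# OPTIONS --safe #-}

-- If an m-autoreduction k of A moves infinitely many numbers, choose x₀ < x₁ < … with k xᵢ ≢ xᵢ
-- and each xₙ above every xᵢ and k xᵢ with i < n. The constraint A xₙ = A (k xₙ) involves the fresh
-- bit xₙ, so flipping that bit shows that the first n constraints cut out a clopen set of measure
-- 2^-n; for computable k these sets form a Martin-Löf test capturing A. Allotting measure ε 2^-(e+1)
-- to the e-th program for k covers all non-rigid sets by measure at most ε. That 2^ω itself has outer
-- measure 1 is seen by descending, from a cover of total r < 1, always into a half of 2^ω in which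
-- the relative total is still at most r: the branch obtained is not covered.
module Submission where

open import Defs
open import Level using (0ℓ)
open import Axiom.ExcludedMiddle using (ExcludedMiddle)
open import Data.Bool.Base using (Bool; true; false; not; _∧_; _xor_; if_then_else_)
open import Data.Empty using (⊥)
open import Data.Fin.Base using (zero; suc)
import Data.Integer.Base as ℤ
import Data.Integer.Properties as ℤ
open import Data.List.Base using (List; []; _∷_; _++_; map; length; concat; upTo; allFin; cartesianProductWith; fromMaybe)
open import Data.List.Membership.Propositional using (_∈_)
open import Data.List.Membership.Propositional.Properties using (∈-map⁺; ∈-++⁺ˡ; ∈-++⁺ʳ; ∈-concat⁺′; ∈-upTo⁺; ∈-allFin; ∈-cartesianProductWith⁺)
open import Data.List.Relation.Unary.Any using (here; there)
open import Data.Maybe.Base using (Maybe; just; nothing)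
open import Data.Nat.Base as ℕ using (ℕ; zero; suc; z≤n; s≤s)
import Data.Nat.Properties as ℕ
open import Data.Product using (_×_; _,_; proj₁; proj₂; ∃; ∃-syntax)
open import Data.Rational using (ℚ; mkℚ; 0ℚ; 1ℚ; ½; _+_; _-_; _*_; -_; _≤_; _<_; *<*; toℚᵘ; ↧ₙ_; nonNegative; +-*-rawSemiring)
import Data.Rational.Properties as ℚ
open import Data.Rational.Solver using (module +-*-Solver)
open import Data.Rational.Unnormalised.Base as ℚᵘ using (mkℚᵘ; *≡*; *≤*)
import Data.Rational.Unnormalised.Properties as ℚᵘ
open import Data.Sum.Base using (inj₁; inj₂)
open import Data.Vec.Base as Vec using (Vec; []; _∷_; head; tail)
open import Data.Vec.Relation.Binary.Pointwise.Inductive using (Pointwise; []; _∷_)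
open import Data.Vec.Relation.Unary.All as All using (All; []; _∷_)
open import Function.Base using (_∘_; case_of_)
open import Function.Bundles using (Equivalence; mk⇔)
open import Relation.Binary.Definitions using (tri<; tri≈; tri>)
open import Relation.Binary.PropositionalEquality using (_≡_; _≢_; refl; sym; trans; cong; cong₂; subst; module ≡-Reasoning)
open import Relation.Nullary using (¬_; yes; no; contradiction)
open import Relation.Nullary.Decidable using (decidable-stable; ¬?)
open import Relation.Unary using (Pred; Decidable; ∁)
open import Algebra.Definitions.RawSemiring +-*-rawSemiring using (_^_)
open +-*-Solver using (solve; con; _:+_; _:-_; _:*_; _:=_)

-- Computable functions

-- For `mu`, the smaller of two distinct roots would lie below the larger one, where a positive
-- value is prescribed.
⇓-functional : ∀ {n} {f : Rec n} {xs y z} → f ⟨ xs ⟩⇓ y → f ⟨ xs ⟩⇓ z → y ≡ z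
⇓-functional* : ∀ {m n} {gs : Vec (Rec n) m} {xs ys zs} →
  Pointwise (λ g y → g ⟨ xs ⟩⇓ y) gs ys → Pointwise (λ g y → g ⟨ xs ⟩⇓ y) gs zs → ys ≡ zs

⇓-functional zero⇓ zero⇓ = refl
⇓-functional suc⇓ suc⇓ = refl
⇓-functional proj⇓ proj⇓ = refl
⇓-functional (comp⇓ gs f) (comp⇓ gs′ f′) with refl ← ⇓-functional* gs gs′ = ⇓-functional f f′
⇓-functional (prec⇓-zero f) (prec⇓-zero f′) = ⇓-functional f f′
⇓-functional (prec⇓-suc r g) (prec⇓-suc r′ g′) with refl ← ⇓-functional r r′ = ⇓-functional g g′
⇓-functional (mu⇓ {y = y} root below) (mu⇓ {y = z} root′ below′) with ℕ.<-cmp y z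
... | tri< y<z _ _ = contradiction (⇓-functional root (proj₂ (below′ y y<z))) λ ()
... | tri≈ _ y≡z _ = y≡z
... | tri> _ _ z<y = contradiction (⇓-functional (proj₂ (below z z<y)) root′) λ ()

⇓-functional* [] [] = refl
⇓-functional* (g ∷ gs) (g′ ∷ gs′) = cong₂ _∷_ (⇓-functional g g′) (⇓-functional* gs gs′)

pattern #0 = zero
pattern #1 = suc zero
pattern #2 = suc (suc zero)

Computableᵛ : ∀ {n} → (Vec ℕ n → ℕ) → Set
Computableᵛ F = ∃[ f ] ∀ xs → f ⟨ xs ⟩⇓ F xs

Computable₂ : (ℕ → ℕ → ℕ) → Set
Computable₂ F = ∃[ f ] ∀ x y → f ⟨ x ∷ y ∷ [] ⟩⇓ F x y

var : ∀ {n} i → Computableᵛ {n} (λ xs → Vec.lookup xs i)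
var i = proj i , λ _ → proj⇓

zero-computable : ∀ {n} → Computableᵛ {n} (λ _ → 0)
zero-computable = zeroᶜ , λ _ → zero⇓

suc-computable : Computable suc
suc-computable = sucᶜ , λ _ → suc⇓

apply : ∀ {n F} {G : Vec ℕ n → ℕ} →
  Computable F → Computableᵛ G → Computableᵛ (F ∘ G)
apply (f , f⇓) (g , g⇓) = comp f (g ∷ []) , λ xs → comp⇓ (g⇓ xs ∷ []) (f⇓ _)

apply₂ : ∀ {n F} {G H : Vec ℕ n → ℕ} →
  Computable₂ F → Computableᵛ G → Computableᵛ H → Computableᵛ (λ xs → F (G xs) (H xs))
apply₂ (f , f⇓) (g , g⇓) (h , h⇓) =
  comp f (g ∷ h ∷ []) , λ xs → comp⇓ (g⇓ xs ∷ h⇓ xs ∷ []) (f⇓ _ _)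

primitive-recursion : ∀ {n} {F : ℕ → Vec ℕ n → ℕ} {B S} →
  Computableᵛ B → Computableᵛ S →
  (∀ xs → B xs ≡ F 0 xs) → (∀ k xs → S (k ∷ F k xs ∷ xs) ≡ F (suc k) xs) →
  Computableᵛ (λ xs → F (head xs) (tail xs))
primitive-recursion {F = F} (b , b⇓) (s , s⇓) base step =
  prec b s , λ { (k ∷ xs) → run k xs }
  where
  run : ∀ k xs → prec b s ⟨ k ∷ xs ⟩⇓ F k xs
  run zero    xs = prec⇓-zero (subst (b ⟨ xs ⟩⇓_) (base xs) (b⇓ xs))
  run (suc k) xs = prec⇓-suc (run k xs) (subst (s ⟨ _ ⟩⇓_) (step k xs) (s⇓ _))

-- The values of `g` may come from a nonconstructive argument; being the least zeros of a computable
-- `F`, they are found by a search.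
minimisation : ∀ {n} {F : Vec ℕ (suc n) → ℕ} (g : Vec ℕ n → ℕ) →
  Computableᵛ F → (∀ xs → F (g xs ∷ xs) ≡ 0) →
  (∀ xs z → z ℕ.< g xs → F (z ∷ xs) ≢ 0) → Computableᵛ g
minimisation {F = F} g (f , f⇓) root below = mu f , λ xs →
  mu⇓ (subst (f ⟨ _ ⟩⇓_) (root xs) (f⇓ _)) λ z z<g → positive (f⇓ (z ∷ xs)) (below xs z z<g)
  where
  positive : ∀ {xs v} → f ⟨ xs ⟩⇓ v → v ≢ 0 → ∃[ u ] f ⟨ xs ⟩⇓ suc u
  positive {v = zero}  _  v≢0 = contradiction refl v≢0
  positive {v = suc u} ⇓v _   = u , ⇓v

-- `F′` ignores the search variable of `mu`, so the search stops at 0 if `F` vanishes and has no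
-- value otherwise.
zeroSet-uniformlyCE : ∀ {F} → Computable₂ F → UniformlyCE (λ n σ → F n (code σ) ≡ 0)
zeroSet-uniformlyCE {F} F-computable = mu (proj₁ F′) , λ n σ → mk⇔
  (λ root → 0 , mu⇓ (subst (proj₁ F′ ⟨ _ ⟩⇓_) root (proj₂ F′ (0 ∷ n ∷ code σ ∷ []))) λ _ ())
  (λ { (_ , mu⇓ root _) → ⇓-functional (proj₂ F′ (_ ∷ n ∷ code σ ∷ [])) root })
  where
  F′ : Computableᵛ {3} (λ xs → F (Vec.lookup xs #1) (Vec.lookup xs #2))
  F′ = apply₂ F-computable (var #1) (var #2)

closed₁ : ∀ {G : Vec ℕ 1 → ℕ} → Computableᵛ G → Computable (λ x → G (x ∷ []))
closed₁ (g , g⇓) = g , λ x → g⇓ (x ∷ [])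

closed₂ : ∀ {G : Vec ℕ 2 → ℕ} → Computableᵛ G → Computable₂ (λ x y → G (x ∷ y ∷ []))
closed₂ (g , g⇓) = g , λ x y → g⇓ (x ∷ y ∷ [])

primrec₁ : ∀ {F S} → Computable₂ S → F 0 ≡ 0 → (∀ k → S k (F k) ≡ F (suc k)) → Computable F
primrec₁ S base step = closed₁ (primitive-recursion zero-computable
  (apply₂ S (var #0) (var #1)) (λ _ → sym base) (λ k _ → step k))

+-computable : Computable₂ ℕ._+_
+-computable = closed₂ (primitive-recursion {F = λ x ys → x ℕ.+ Vec.lookup ys #0}
  (var #0) (apply suc-computable (var #1)) (λ _ → refl) (λ _ _ → refl))

pred-computable : Computable ℕ.pred
pred-computable = closed₁ (primitive-recursion {F = λ x _ → ℕ.pred x}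
  zero-computable (var #0) (λ _ → refl) (λ _ _ → refl))

∸-computable : Computable₂ ℕ._∸_
-- `prec` recurses on the first argument, truncated subtraction on the second.
∸-computable = closed₂ (apply₂ {F = λ y x → x ℕ.∸ y} flipped (var #1) (var #0))
  where
  flipped : Computable₂ (λ y x → x ℕ.∸ y)
  flipped = closed₂ (primitive-recursion {F = λ y xs → Vec.lookup xs #0 ℕ.∸ y}
    (var #0) (apply pred-computable (var #1)) (λ _ → refl)
    (λ y xs → ℕ.pred[m∸n]≡m∸[1+n] (Vec.lookup xs #0) y))

-- The absolute difference, since one of the two truncated differences is always 0. It turns
-- equations into zero tests.
distance : ℕ → ℕ → ℕ
distance a b = (a ℕ.∸ b) ℕ.+ (b ℕ.∸ a)

distance≡0⇒≡ : ∀ a b → distance a b ≡ 0 → a ≡ b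
distance≡0⇒≡ a b eq = ℕ.≤-antisym (ℕ.m∸n≡0⇒m≤n (ℕ.m+n≡0⇒m≡0 (a ℕ.∸ b) eq))
  (ℕ.m∸n≡0⇒m≤n (ℕ.m+n≡0⇒n≡0 (a ℕ.∸ b) eq))

distance-self : ∀ a → distance a a ≡ 0
distance-self a = cong₂ ℕ._+_ (ℕ.n∸n≡0 a) (ℕ.n∸n≡0 a)

distance-computable : ∀ {n} {G H : Vec ℕ n → ℕ} → Computableᵛ G → Computableᵛ H →
  Computableᵛ (λ xs → distance (G xs) (H xs))
distance-computable G H =
  apply₂ +-computable (apply₂ ∸-computable G H) (apply₂ ∸-computable H G)

one-computable : ∀ {n} → Computableᵛ {n} (λ _ → 1)
one-computable = apply suc-computable zero-computable

-- Reading the bits of a string from its code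

-- Counting up in bijective base 2, the first digit alternates between 1 and 2, and the remaining
-- digits count up by one whenever it returns from 2 to 1. The empty numeral gets first digit 0.
firstDigit : ℕ → ℕ
firstDigit zero    = 0
firstDigit (suc c) = suc (1 ℕ.∸ distance (firstDigit c) 1)

otherDigits : ℕ → ℕ
otherDigits zero    = 0
otherDigits (suc c) = otherDigits c ℕ.+ (firstDigit c ℕ.∸ 1)

dropDigits : ℕ → ℕ → ℕ
dropDigits zero    c = c
dropDigits (suc j) c = otherDigits (dropDigits j c)

digit : ℕ → ℕ → ℕ
digit j c = firstDigit (dropDigits j c)

firstDigit-computable : Computable firstDigit
firstDigit-computable = primrec₁
  (closed₂ (apply suc-computable (apply₂ ∸-computable one-computable
    (distance-computable (var #1) one-computable)))) refl (λ _ → refl)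

otherDigits-computable : Computable otherDigits
otherDigits-computable = primrec₁ (closed₂
  (apply₂ +-computable (var #1)
    (apply₂ ∸-computable (apply firstDigit-computable (var #0)) one-computable)))
  refl (λ _ → refl)

digit-computable : Computable₂ digit
digit-computable = closed₂ (apply firstDigit-computable (primitive-recursion {F = λ j xs → dropDigits j (Vec.lookup xs #0)}
  (var #0) (apply otherDigits-computable (var #1)) (λ _ → refl) (λ _ _ → refl)))

successor-of-1 : ∀ c → firstDigit c ≡ 1 →
  firstDigit (suc c) ≡ 2 × otherDigits (suc c) ≡ otherDigits c
successor-of-1 c first rewrite first = refl , ℕ.+-identityʳ _

successor-of-2 : ∀ c → firstDigit c ≡ 2 →
  firstDigit (suc c) ≡ 1 × otherDigits (suc c) ≡ suc (otherDigits c)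
successor-of-2 c first rewrite first = refl , ℕ.+-comm _ 1

-- Passing from c to c + 1 takes two successors of 1 + 2c. The first digit goes from 1 to 2 and back
-- to 1, and only the second successor raises the remaining digits.
odd-digits : ∀ c → firstDigit (1 ℕ.+ 2 ℕ.* c) ≡ 1 × otherDigits (1 ℕ.+ 2 ℕ.* c) ≡ c
odd-digits zero = refl , refl
odd-digits (suc c)
  with first , others ← odd-digits c
  with first′ , others′ ← successor-of-1 (1 ℕ.+ 2 ℕ.* c) first
  with first″ , others″ ← successor-of-2 (2 ℕ.+ 2 ℕ.* c) first′ =
  subst (λ m → firstDigit (1 ℕ.+ m) ≡ 1 × otherDigits (1 ℕ.+ m) ≡ suc c) (sym (ℕ.*-suc 2 c))
    (first″ , trans others″ (cong suc (trans others′ others)))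

digits-code : ∀ b σ → firstDigit (code (b ∷ σ)) ≡ suc (bit b) × otherDigits (code (b ∷ σ)) ≡ code σ
digits-code false σ = odd-digits (code σ)
digits-code true  σ
  with first , others ← odd-digits (code σ)
  with first′ , others′ ← successor-of-1 (1 ℕ.+ 2 ℕ.* code σ) first =
  first′ , trans others′ others

-- `dropDigits` adds each further removal on the outside, while recursion along a string removes the
-- first bit first.
dropDigits-otherDigits : ∀ j c → dropDigits j (otherDigits c) ≡ dropDigits (suc j) c
dropDigits-otherDigits zero    c = refl
dropDigits-otherDigits (suc j) c = cong otherDigits (dropDigits-otherDigits j c)

-- 0 past the end of the string
symbol : ℕ → String → ℕ
symbol _       []      = 0
symbol zero    (b ∷ σ) = suc (bit b)
symbol (suc j) (b ∷ σ) = symbol j σ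

digit-code : ∀ j σ → digit j (code σ) ≡ symbol j σ
digit-code zero    []      = refl
digit-code (suc j) []      = trans (cong firstDigit (sym (dropDigits-otherDigits j 0))) (digit-code j [])
digit-code zero    (b ∷ σ) = proj₁ (digits-code b σ)
digit-code (suc j) (b ∷ σ) = trans
  (cong firstDigit (trans (sym (dropDigits-otherDigits j (code (b ∷ σ)))) (cong (dropDigits j) (proj₂ (digits-code b σ)))))
  (digit-code j σ)

symbol-∈ : ∀ j σ {X} → [ σ ] X → symbol j σ ≢ 0 → symbol j σ ≡ suc (bit (X j))
symbol-∈ _       []      _   ≢0 = contradiction refl ≢0
symbol-∈ zero    (b ∷ σ) X∈σ _  = cong (suc ∘ bit) (X∈σ zero)
symbol-∈ (suc j) (b ∷ σ) X∈σ ≢0 = symbol-∈ j σ (X∈σ ∘ suc) ≢0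

prefix : ℕ → Cantor → String
prefix zero    X = []
prefix (suc n) X = X 0 ∷ prefix n (X ∘ suc)

prefix-∈ : ∀ n X → [ prefix n X ] X
prefix-∈ (suc n) X zero    = refl
prefix-∈ (suc n) X (suc i) = prefix-∈ n (X ∘ suc) i

symbol-prefix : ∀ {j n} X → j ℕ.< n → symbol j (prefix n X) ≡ suc (bit (X j))
symbol-prefix {zero}  X (s≤s _)   = refl
symbol-prefix {suc j} X (s≤s j<n) = symbol-prefix (X ∘ suc) j<n

-- Vanishes exactly when a and b are equal and positive. As `symbol` is 0 past the end, a string too
-- short to contain both positions violates the constraint.
violation : ℕ → ℕ → ℕ
violation a b = distance a b ℕ.+ (1 ℕ.∸ a)

violation≡0 : ∀ a b → violation a b ≡ 0 → a ≡ b × a ≢ 0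
violation≡0 a b eq = distance≡0⇒≡ a b (ℕ.m+n≡0⇒m≡0 _ eq) ,
  λ { refl → ℕ.1+n≢0 (ℕ.m+n≡0⇒n≡0 (distance 0 b) eq) }

bit-injective : ∀ {b c} → bit b ≡ bit c → b ≡ c
bit-injective {false} {false} _ = refl
bit-injective {true}  {true}  _ = refl

violation-code≡0 : ∀ i j σ {X} → [ σ ] X →
  violation (digit i (code σ)) (digit j (code σ)) ≡ 0 → X i ≡ X j
violation-code≡0 i j σ X∈σ eq
  rewrite digit-code i σ | digit-code j σ
  with same , ≢0 ← violation≡0 (symbol i σ) (symbol j σ) eq =
  bit-injective (ℕ.suc-injective (trans (sym (symbol-∈ i σ X∈σ ≢0))
    (trans same (symbol-∈ j σ X∈σ (≢0 ∘ trans same)))))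

violation-prefix≡0 : ∀ {i j n} X → i ℕ.< n → j ℕ.< n → X i ≡ X j →
  violation (digit i (code (prefix n X))) (digit j (code (prefix n X))) ≡ 0
violation-prefix≡0 {i} {j} {n} X i<n j<n same
  rewrite digit-code i (prefix n X) | digit-code j (prefix n X)
        | symbol-prefix X i<n | symbol-prefix X j<n | same
        | distance-self (bit (X j)) | ℕ.0∸n≡0 (bit (X j)) = refl

-- Moved numbers and the constraints they impose

least : ∀ {P : Pred ℕ 0ℓ} → Decidable P → ∀ n → P n →
  ∃[ m ] P m × (∀ z → z ℕ.< m → ¬ P z)
least P? n Pn with P? 0
... | yes P0 = 0 , P0 , λ _ ()
least P? zero    Pn | no ¬P0 = contradiction Pn ¬P0
least P? (suc n) Pn | no ¬P0 with m , Pm , below ← least (P? ∘ suc) n Pn =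
  suc m , Pm , λ { zero _ → ¬P0 ; (suc z) (s≤s z<m) → below z z<m }

-- Here y is counted from m, so that the search for it starts at 0.
IsLeastMoved : (ℕ → ℕ) → ℕ → ℕ → Set
IsLeastMoved k m y = k (m ℕ.+ y) ≢ m ℕ.+ y × (∀ z → z ℕ.< y → k (m ℕ.+ z) ≡ m ℕ.+ z)

-- Were no number from m on moved, m would witness that `k` is eventually the identity.
leastMoved : ExcludedMiddle 0ℓ → ∀ k → ¬ EventuallyIdentity k → ∀ m → ∃ (IsLeastMoved k m)
leastMoved em k ¬id m with em {∃[ y ] k (m ℕ.+ y) ≢ m ℕ.+ y}
... | no fixed = contradiction
  (m , λ x m≤x → decidable-stable (k x ℕ.≟ x) λ kx≢x →
    fixed (x ℕ.∸ m , subst (λ x → k x ≢ x) (sym (ℕ.m+[n∸m]≡n m≤x)) kx≢x))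
  ¬id
... | yes (y , moved) with least (λ y → ¬? (k (m ℕ.+ y) ℕ.≟ m ℕ.+ y)) y moved
...   | y , moved , below = y , moved , λ z z<y → decidable-stable (_ ℕ.≟ _) (below z z<y)

module Constraints (k : ℕ → ℕ) (offset : ℕ → ℕ) where

  next : ℕ → ℕ
  next m = m ℕ.+ offset m

  -- The successor of the sum exceeds both the i-th point and its image, so each new point is fresh
  -- for all earlier constraints.
  bound : ℕ → ℕ
  bound zero    = 0
  bound (suc i) = suc (next (bound i) ℕ.+ k (next (bound i)))

  point : ℕ → ℕ
  point i = next (bound i)

  bound≤point : ∀ i → bound i ℕ.≤ point i
  bound≤point i = ℕ.m≤m+n _ _

  point<bound : ∀ i → point i ℕ.< bound (suc i)
  point<bound i = s≤s (ℕ.m≤m+n _ _)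

  image<bound : ∀ i → k (point i) ℕ.< bound (suc i)
  image<bound i = s≤s (ℕ.m≤n+m _ _)

  bound-mono : ∀ {i n} → i ℕ.≤ n → bound i ℕ.≤ bound n
  bound-mono {n = zero}  z≤n = z≤n
  bound-mono {i} {n = suc n} i≤1+n with ℕ.m≤n⇒m<n∨m≡n i≤1+n
  ... | inj₂ refl      = ℕ.≤-refl
  ... | inj₁ (s≤s i≤n) = ℕ.≤-trans (bound-mono i≤n) (ℕ.≤-trans (bound≤point n) (ℕ.<⇒≤ (point<bound n)))

  violations : ℕ → ℕ → ℕ
  violations zero    c = 0
  violations (suc i) c = violations i c ℕ.+ violation (digit (point i) c) (digit (k (point i)) c)

  violations-code≡0 : ∀ n σ {X} → [ σ ] X → violations n (code σ) ≡ 0 →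
    ∀ i → i ℕ.< n → X (point i) ≡ X (k (point i))
  violations-code≡0 (suc n) σ {X} X∈σ eq i i<1+n with ℕ.m≤n⇒m<n∨m≡n (ℕ.≤-pred i<1+n)
  ... | inj₁ i<n = violations-code≡0 n σ {X} X∈σ (ℕ.m+n≡0⇒m≡0 _ eq) i i<n
  ... | inj₂ refl =
    violation-code≡0 (point i) (k (point i)) σ {X} X∈σ (ℕ.m+n≡0⇒n≡0 (violations i (code σ)) eq)

  -- From length `bound n` on, a prefix contains all positions that the first n constraints read.
  violations-prefix≡0 : ∀ n {L} X → (∀ i → i ℕ.< n → X (point i) ≡ X (k (point i))) →
    bound n ℕ.≤ L → violations n (code (prefix L X)) ≡ 0
  violations-prefix≡0 zero    X _    _ = refl
  violations-prefix≡0 (suc n) X same b≤L = cong₂ ℕ._+_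
    (violations-prefix≡0 n X (λ i i<n → same i (ℕ.m≤n⇒m≤1+n i<n))
      (ℕ.≤-trans (bound-mono (ℕ.n≤1+n n)) b≤L))
    (violation-prefix≡0 X (ℕ.≤-trans (point<bound n) b≤L) (ℕ.≤-trans (image<bound n) b≤L)
      (same n ℕ.≤-refl))

  offset-computable : Computable k → (∀ m → IsLeastMoved k m (offset m)) → Computable offset
  offset-computable k-computable isLeast = closed₁ (minimisation {F = λ xs → test (Vec.lookup xs #0) (Vec.lookup xs #1)}
    (λ xs → offset (Vec.lookup xs #0))
    (apply₂ ∸-computable one-computable (distance-computable (apply k-computable sum) sum))
    (λ { (m ∷ []) → ℕ.m≤n⇒m∸n≡0 (ℕ.n≢0⇒n>0 λ eq → proj₁ (isLeast m) (distance≡0⇒≡ _ _ eq)) })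
    (λ { (m ∷ []) z z<y → nonzero (proj₂ (isLeast m) z z<y) }))
    where
    test : ℕ → ℕ → ℕ
    -- The outer `1 ∸` exchanges zero and nonzero: the search has to stop where `k` moves the
    -- number.
    test y m = 1 ℕ.∸ distance (k (m ℕ.+ y)) (m ℕ.+ y)
    sum : Computableᵛ {2} (λ xs → Vec.lookup xs #1 ℕ.+ Vec.lookup xs #0)
    sum = apply₂ +-computable (var #1) (var #0)
    nonzero : ∀ {a b} → a ≡ b → 1 ℕ.∸ distance a b ≢ 0
    nonzero {a} refl rewrite distance-self a = λ ()

  violations-computable : Computable k → Computable offset → Computable₂ violations
  violations-computable k-computable o-computable = closed₂ (primitive-recursion {F = λ n xs → violations n (Vec.lookup xs #0)}
    zero-computable
    (apply₂ +-computable (var #1) (apply₂ +-computable (distance-computable a b) (apply₂ ∸-computable one-computable a)))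
    (λ _ → refl) (λ _ _ → refl))
    where
    next-computable : Computable next
    next-computable = closed₁ (apply₂ +-computable (var #0) (apply o-computable (var #0)))
    bound-computable : Computable bound
    bound-computable = primrec₁ {S = λ _ r → suc (next r ℕ.+ k (next r))} (closed₂
      (apply suc-computable (apply₂ +-computable
      (apply next-computable (var #1)) (apply k-computable (apply next-computable (var #1)))))) refl (λ _ → refl)
    p : Computableᵛ {3} (λ xs → point (Vec.lookup xs #0))
    p = apply next-computable (apply bound-computable (var #0))
    a = apply₂ digit-computable p (var #2)
    b = apply₂ digit-computable (apply k-computable p) (var #2)

-- Outer measure

halves : ∀ p → ½ * p + ½ * p ≡ p
halves = solve 1 (λ p → con ½ :* p :+ con ½ :* p := p) refl

½^n≥0 : ∀ n → 0ℚ ≤ ½ ^ n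
½^n≥0 zero    = ℚ.nonNegative⁻¹ 1ℚ
½^n≥0 (suc n) = subst (_≤ ½ ^ suc n) (ℚ.*-zeroʳ ½) (ℚ.*-monoˡ-≤-nonNeg ½ (½^n≥0 n))

p≤p+q : ∀ p {q} → 0ℚ ≤ q → p ≤ p + q
p≤p+q p {q} 0≤q = subst (_≤ p + q) (ℚ.+-identityʳ p) (ℚ.+-monoʳ-≤ p 0≤q)

weight≥0 : ∀ s → 0ℚ ≤ weight s
weight≥0 nothing  = ℚ.≤-refl
weight≥0 (just σ) = ½^n≥0 (length σ)

-- Lists of cylinders and their flattening into a family

total : List String → ℚ
total []      = 0ℚ
total (σ ∷ l) = ½ ^ length σ + total l

total≥0 : ∀ l → 0ℚ ≤ total l
total≥0 []      = ℚ.≤-refl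
total≥0 (σ ∷ l) = ℚ.≤-trans (½^n≥0 (length σ)) (p≤p+q _ (total≥0 l))

total-++ : ∀ l l′ → total (l ++ l′) ≡ total l + total l′
total-++ []      l′ = sym (ℚ.+-identityˡ _)
total-++ (σ ∷ l) l′ = trans (cong (½ ^ length σ +_) (total-++ l l′)) (sym (ℚ.+-assoc (½ ^ length σ) (total l) (total l′)))

total-map-∷ : ∀ b l → total (map (b ∷_) l) ≡ ½ * total l
total-map-∷ b []      = refl
total-map-∷ b (σ ∷ l) = trans (cong (½ ^ suc (length σ) +_) (total-map-∷ b l)) (sym (ℚ.*-distribˡ-+ ½ (½ ^ length σ) (total l)))

total-fromMaybe : ∀ s → total (fromMaybe s) ≡ weight s
total-fromMaybe nothing  = refl
total-fromMaybe (just σ) = ℚ.+-identityʳ _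

-- The first argument is the unread rest of the current list. Opening the next list uses up an
-- index, filled with `nothing`; this keeps the recursion structural in the index even when
-- infinitely many lists are empty.
drain : ∀ {A : Set} → List A → (ℕ → List A) → ℕ → Maybe A
drain []       L zero    = nothing
drain []       L (suc n) = drain (L 0) (L ∘ suc) n
drain (a ∷ as) L zero    = just a
drain (a ∷ as) L (suc n) = drain as L n

flatten : ∀ {A : Set} → (ℕ → List A) → ℕ → Maybe A
flatten = drain []

drain-now : ∀ {A : Set} {a : A} {as} L → a ∈ as → ∃[ n ] drain as L n ≡ just a
drain-now L (here refl) = 0 , refl
drain-now L (there a∈as) with n , eq ← drain-now L a∈as = suc n , eq

drain-later : ∀ {A : Set} {a : A} as L → ∃[ n ] flatten L n ≡ just a → ∃[ n ] drain as L n ≡ just a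
drain-later []       L later = later
drain-later (_ ∷ as) L later with n , eq ← drain-later as L later = suc n , eq

flatten-surjective : ∀ {A : Set} {a : A} L e → a ∈ L e → ∃[ n ] flatten L n ≡ just a
flatten-surjective L zero    a∈Le with n , eq ← drain-now (L ∘ suc) a∈Le = suc n , eq
flatten-surjective L (suc e) a∈Le
  with n , eq ← drain-later (L 0) (L ∘ suc) (flatten-surjective (L ∘ suc) e a∈Le) = suc n , eq

partialSum-suc : ∀ w n → partialSum w (suc n) ≡ weight (w 0) + partialSum (w ∘ suc) n
partialSum-suc w zero    = ℚ.+-comm 0ℚ (weight (w 0))
partialSum-suc w (suc n) = trans (cong (_+ weight (w (suc n))) (partialSum-suc w n))
  (ℚ.+-assoc (weight (w 0)) (partialSum (w ∘ suc) n) (weight (w (suc n))))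

partialSum-mono : ∀ w {m n} → m ℕ.≤ n → partialSum w m ≤ partialSum w n
partialSum-mono w {n = zero}  z≤n = ℚ.≤-refl
partialSum-mono w {n = suc n} m≤1+n with ℕ.m≤n⇒m<n∨m≡n m≤1+n
... | inj₂ refl      = ℚ.≤-refl
... | inj₁ (s≤s m≤n) = ℚ.≤-trans (partialSum-mono w m≤n) (p≤p+q _ (weight≥0 (w n)))

totals : (ℕ → List String) → ℕ → ℚ
totals L zero    = 0ℚ
totals L (suc n) = total (L 0) + totals (L ∘ suc) n

totals-step : ∀ L n → totals L n ≤ totals L (suc n)
totals-step L zero    = ℚ.≤-trans (total≥0 (L 0)) (p≤p+q _ ℚ.≤-refl)
totals-step L (suc n) = ℚ.+-monoʳ-≤ (total (L 0)) (totals-step (L ∘ suc) n)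

-- Opening a list uses up an index, so the first n entries draw on `l` and at most n lists of `L`.
partialSum-drain : ∀ l L n → partialSum (drain l L) n ≤ total l + totals L n
partialSum-drain l L zero = ℚ.≤-trans (total≥0 l) (p≤p+q _ ℚ.≤-refl)
partialSum-drain [] L (suc n) = begin
  partialSum (flatten L) (suc n)             ≡⟨ partialSum-suc (flatten L) n ⟩
  0ℚ + partialSum (drain (L 0) (L ∘ suc)) n  ≤⟨ ℚ.+-monoʳ-≤ 0ℚ (partialSum-drain (L 0) (L ∘ suc) n) ⟩
  0ℚ + totals L (suc n)                      ∎
  where open ℚ.≤-Reasoning
partialSum-drain (σ ∷ l) L (suc n) = begin
  partialSum (drain (σ ∷ l) L) (suc n)       ≡⟨ partialSum-suc (drain (σ ∷ l) L) n ⟩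
  ½ ^ length σ + partialSum (drain l L) n    ≤⟨ ℚ.+-monoʳ-≤ (½ ^ length σ) (partialSum-drain l L n) ⟩
  ½ ^ length σ + (total l + totals L n)      ≤⟨ ℚ.+-monoʳ-≤ (½ ^ length σ) (ℚ.+-monoʳ-≤ (total l) (totals-step L n)) ⟩
  ½ ^ length σ + (total l + totals L (suc n)) ≡⟨ ℚ.+-assoc (½ ^ length σ) (total l) _ ⟨
  total (σ ∷ l) + totals L (suc n)           ∎
  where open ℚ.≤-Reasoning

flatten-total : ∀ {L q} → (∀ n → totals L n ≤ q) → TotalAtMost (flatten L) q
flatten-total {L} totals≤q n = ℚ.≤-trans (partialSum-drain [] L n)
  (subst (_≤ _) (sym (ℚ.+-identityˡ _)) (totals≤q n))

flatten-covers : ∀ {L : ℕ → List String} {S : Pred Cantor 0ℓ} →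
  (∀ {X} → S X → ∃[ e ] ∃[ σ ] σ ∈ L e × [ σ ] X) → Covers (flatten L) S
flatten-covers {L} cover X∈S with e , σ , σ∈Le , X∈σ ← cover X∈S
  with n , eq ← flatten-surjective L e σ∈Le = n , σ , eq , X∈σ

finite-cover : ∀ {S : Pred Cantor 0ℓ} {q} l → total l ≤ q →
  (∀ {X} → S X → ∃[ σ ] σ ∈ l × [ σ ] X) → OuterMeasure≤ S q
finite-cover {S} {q} l l≤q cover ε 0<ε =
  flatten L , flatten-covers {L} {S} (λ X∈S → 0 , cover X∈S) , flatten-total {L} bound
  where
  L : ℕ → List String
  L zero    = l
  L (suc _) = []
  empty : ∀ n → totals (λ _ → []) n ≡ 0ℚ
  empty zero    = refl
  empty (suc n) = cong (0ℚ +_) (empty n)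
  l≤q+ε : total l ≤ q + ε
  l≤q+ε = ℚ.≤-trans l≤q (p≤p+q q (ℚ.<⇒≤ 0<ε))
  bound : ∀ n → totals L n ≤ q + ε
  bound zero    = ℚ.≤-trans (total≥0 l) l≤q+ε
  bound (suc n) = subst (_≤ q + ε)
    (sym (trans (cong (total l +_) (empty n)) (ℚ.+-identityʳ _))) l≤q+ε

-- Subadditivity at the level of covers: list e holds the e-th cylinders of both families.
union-total : ∀ {w w′ r r′} → TotalAtMost w r → TotalAtMost w′ r′ →
  TotalAtMost (flatten (λ e → fromMaybe (w e) ++ fromMaybe (w′ e))) (r + r′)
union-total {w} {w′} w≤r w′≤r′ = flatten-total {λ e → fromMaybe (w e) ++ fromMaybe (w′ e)} λ n →
  subst (_≤ _) (sym (sums w w′ n)) (ℚ.+-mono-≤ (w≤r n) (w′≤r′ n))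
  where
  sums : ∀ w w′ n → totals (λ e → fromMaybe (w e) ++ fromMaybe (w′ e)) n ≡ partialSum w n + partialSum w′ n
  sums w w′ zero = refl
  sums w w′ (suc n) = begin
    total (fromMaybe (w 0) ++ fromMaybe (w′ 0)) + totals (λ e → fromMaybe (w (suc e)) ++ fromMaybe (w′ (suc e))) n
      ≡⟨ cong₂ _+_ (trans (total-++ (fromMaybe (w 0)) _) (cong₂ _+_ (total-fromMaybe (w 0)) (total-fromMaybe (w′ 0))))
                   (sums (w ∘ suc) (w′ ∘ suc) n) ⟩
    (weight (w 0) + weight (w′ 0)) + (partialSum (w ∘ suc) n + partialSum (w′ ∘ suc) n)
      ≡⟨ solve 4 (λ a b c d → (a :+ b) :+ (c :+ d) := (a :+ c) :+ (b :+ d)) refl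
           (weight (w 0)) (weight (w′ 0)) (partialSum (w ∘ suc) n) (partialSum (w′ ∘ suc) n) ⟩
    (weight (w 0) + partialSum (w ∘ suc) n) + (weight (w′ 0) + partialSum (w′ ∘ suc) n)
      ≡⟨ cong₂ _+_ (partialSum-suc w n) (partialSum-suc w′ n) ⟨
    partialSum w (suc n) + partialSum w′ (suc n) ∎
    where open ≡-Reasoning

-- Descent into the lighter half

-- The part of a cylinder inside [ b ∷ [] ], as a subset of 2^ω after deleting the first bit.
restrict : Bool → Maybe String → Maybe String
restrict b     nothing            = nothing
restrict b     (just [])          = just []
restrict false (just (false ∷ σ)) = just σ
restrict true  (just (true  ∷ σ)) = just σ
restrict _     (just (_     ∷ _)) = nothing

restrict-∷ : ∀ b {σ} → restrict b (just (b ∷ σ)) ≡ just σ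
restrict-∷ false = refl
restrict-∷ true  = refl

-- The cylinder of a nonempty string lies in one half and doubles its weight there; the whole space
-- has weight 1 in each half.
weight-restrict : ∀ s → ½ * (weight (restrict false s) + weight (restrict true s)) ≡ weight s
weight-restrict nothing            = refl
weight-restrict (just [])          = refl
weight-restrict (just (false ∷ σ)) = cong (½ *_) (ℚ.+-identityʳ (½ ^ length σ))
weight-restrict (just (true  ∷ σ)) = cong (½ *_) (ℚ.+-identityˡ (½ ^ length σ))

partialSum-restrict : ∀ w n →
  ½ * (partialSum (restrict false ∘ w) n + partialSum (restrict true ∘ w) n) ≡ partialSum w n
partialSum-restrict w zero    = refl
partialSum-restrict w (suc n) = trans
  (solve 4 (λ a b c d → con ½ :* ((a :+ b) :+ (c :+ d)) := con ½ :* (a :+ c) :+ con ½ :* (b :+ d)) refl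
    (partialSum (restrict false ∘ w) n) _ (partialSum (restrict true ∘ w) n) _)
  (cong₂ _+_ (partialSum-restrict w n) (weight-restrict (w n)))

module _ (em : ExcludedMiddle 0ℓ) where

  -- The total is the mean of the totals in the two halves, so these cannot both exceed r.
  lighter-half : ∀ {w r} → TotalAtMost w r → ∃[ b ] TotalAtMost (restrict b ∘ w) r
  lighter-half {w} {r} w≤r with em {∃[ n ] r < partialSum (restrict false ∘ w) n}
  ... | no none = false , λ n → ℚ.≮⇒≥ λ r< → none (n , r<)
  -- Partial sums never decrease, so both would exceed r at the common index `m ⊔ n`.
  ... | yes (m , r<false) = true , λ n → ℚ.≮⇒≥ λ r<true →
    ℚ.<-irrefl refl (begin-strict
      r                  ≡⟨ halves r ⟨
      ½ * r + ½ * r      ≡⟨ ℚ.*-distribˡ-+ ½ r r ⟨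
      ½ * (r + r)        <⟨ ℚ.*-monoʳ-<-pos ½ (ℚ.+-mono-<
                              (ℚ.<-≤-trans r<false (partialSum-mono _ (ℕ.m≤m⊔n m n)))
                              (ℚ.<-≤-trans r<true (partialSum-mono _ (ℕ.m≤n⊔m m n)))) ⟩
      ½ * (partialSum (restrict false ∘ w) (m ℕ.⊔ n) + partialSum (restrict true ∘ w) (m ℕ.⊔ n))
                         ≡⟨ partialSum-restrict w (m ℕ.⊔ n) ⟩
      partialSum w (m ℕ.⊔ n) ≤⟨ w≤r (m ℕ.⊔ n) ⟩
      r                  ∎)
    where open ℚ.≤-Reasoning

  lightBranch : ∀ w {r} → TotalAtMost w r → Cantor
  lightBranch w w≤r zero    = proj₁ (lighter-half {w} w≤r)
  lightBranch w w≤r (suc n) = lightBranch _ (proj₂ (lighter-half {w} w≤r)) n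

  -- Each bit that σ shares with the branch leads into the restricted family, where σ is replaced by
  -- its tail. The empty string reached at the end would contribute weight 1, more than r.
  lightBranch-avoids : ∀ {w r} (w≤r : TotalAtMost w r) → r < 1ℚ →
    ∀ {i} σ → w i ≡ just σ → ¬ [ σ ] (lightBranch w w≤r)
  lightBranch-avoids {w} w≤r r<1 {i} [] wi≡ _ = ℚ.<-irrefl refl (ℚ.<-≤-trans r<1 (begin
    1ℚ                  ≡⟨ cong weight wi≡ ⟨
    weight (w i)        ≡⟨ ℚ.+-identityˡ _ ⟨
    0ℚ + weight (w i)   ≤⟨ ℚ.+-monoˡ-≤ (weight (w i)) (partialSum-mono w (z≤n {i})) ⟩
    partialSum w (suc i) ≤⟨ w≤r (suc i) ⟩
    _                   ∎))
    where open ℚ.≤-Reasoning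
  lightBranch-avoids {w} w≤r r<1 {i} (b ∷ σ) wi≡ X∈ =
    lightBranch-avoids (proj₂ (lighter-half {w} w≤r)) r<1 {i} σ
      (trans (cong₂ restrict (sym (X∈ zero)) wi≡) (restrict-∷ b)) (X∈ ∘ suc)

  cantor-outerMeasure≥1 : ∀ {w r} → (∀ X → ∃[ i ] ∃[ σ ] w i ≡ just σ × [ σ ] X) → TotalAtMost w r → 1ℚ ≤ r
  cantor-outerMeasure≥1 {w} cover w≤r = ℚ.≮⇒≥ λ r<1 →
    case cover (lightBranch w w≤r) of λ
      { (i , σ , wi≡ , X∈σ) → lightBranch-avoids w≤r r<1 σ wi≡ X∈σ }

  -- Suppose a cover of `S` had total r < 1, and take s strictly between r and 1. Adding a cover of
  -- the complement of total at most s - r would cover the whole space with total at most s.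
  conull : ∀ {S : Pred Cantor 0ℓ} → OuterMeasure≤ (∁ S) 0ℚ → HasMeasure S 1ℚ
  conull {S} ∁S-null =
    (finite-cover ([] ∷ []) ℚ.≤-refl (λ _ → [] , here refl , λ ()) , S≥1) ,
    -- `1ℚ - 1ℚ` reduces to 0, and a bound on all partial sums bounds the empty one, which is 0.
    (∁S-null , λ w _ r w≤r → w≤r 0)
    where
    S≥1 : OuterMeasure≥ S 1ℚ
    S≥1 w w-covers r w≤r = ℚ.≮⇒≥ λ r<1 → refute r<1
      where
      refute : r < 1ℚ → ⊥
      refute r<1
        with s , r<s , s<1 ← ℚ.<-dense r<1
        with w′ , w′-covers , w′≤ ← ∁S-null (s - r)
          (subst (_< s - r) (ℚ.+-inverseʳ r) (ℚ.+-monoˡ-< (- r) r<s)) =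
        ℚ.<-irrefl refl (ℚ.<-≤-trans s<1 (cantor-outerMeasure≥1 {flatten L} cover
          (subst (TotalAtMost (flatten L)) (r+s-r≡s) (union-total w≤r w′≤))))
        where
        L : ℕ → List String
        L e = fromMaybe (w e) ++ fromMaybe (w′ e)
        r+s-r≡s : r + (0ℚ + (s - r)) ≡ s
        r+s-r≡s = solve 2 (λ r s → r :+ (con 0ℚ :+ (s :- r)) := s) refl r s
        ∈-fromMaybe : ∀ {s : Maybe String} {σ} → s ≡ just σ → σ ∈ fromMaybe s
        ∈-fromMaybe refl = here refl
        cover : ∀ X → ∃[ i ] ∃[ σ ] flatten L i ≡ just σ × [ σ ] X
        cover X with em {S X}
        ... | yes X∈S with i , σ , wi≡ , X∈σ ← w-covers X∈S
          with n , eq ← flatten-surjective L i (∈-++⁺ˡ (∈-fromMaybe wi≡)) = n , σ , eq , X∈σ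
        ... | no X∉S with i , σ , wi≡ , X∈σ ← w′-covers X∉S
          with n , eq ← flatten-surjective L i (∈-++⁺ʳ (fromMaybe (w i)) (∈-fromMaybe wi≡)) =
          n , σ , eq , X∈σ

-- Independent constraints

solutions : ℕ → (String → Bool) → List String
solutions zero    P = if P [] then [] ∷ [] else []
solutions (suc n) P = map (false ∷_) (solutions n (P ∘ (false ∷_))) ++ map (true ∷_) (solutions n (P ∘ (true ∷_)))

∈-solutions : ∀ n P X → P (prefix n X) ≡ true → prefix n X ∈ solutions n P
∈-solutions zero    P X PX rewrite PX = here refl
∈-solutions (suc n) P X PX with X 0
... | false = ∈-++⁺ˡ (∈-map⁺ (false ∷_) (∈-solutions n (P ∘ (false ∷_)) (X ∘ suc) PX))
... | true  = ∈-++⁺ʳ (map (false ∷_) (solutions n (P ∘ (false ∷_))))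
                (∈-map⁺ (true ∷_) (∈-solutions n (P ∘ (true ∷_)) (X ∘ suc) PX))

-- The measure of the clopen set of all X whose prefix of length n satisfies P, obtained by
-- averaging over the first bit.
proportion : ℕ → (String → Bool) → ℚ
proportion zero    P = if P [] then 1ℚ else 0ℚ
proportion (suc n) P = ½ * (proportion n (P ∘ (false ∷_)) + proportion n (P ∘ (true ∷_)))

total-solutions : ∀ n P → total (solutions n P) ≡ proportion n P
total-solutions zero P with P []
... | true  = refl
... | false = refl
total-solutions (suc n) P = begin
  total (map (false ∷_) l ++ map (true ∷_) r)          ≡⟨ total-++ (map (false ∷_) l) (map (true ∷_) r) ⟩
  total (map (false ∷_) l) + total (map (true ∷_) r)   ≡⟨ cong₂ _+_ (total-map-∷ false l) (total-map-∷ true r) ⟩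
  ½ * total l + ½ * total r                            ≡⟨ ℚ.*-distribˡ-+ ½ (total l) (total r) ⟨
  ½ * (total l + total r)                              ≡⟨ cong₂ (λ p q → ½ * (p + q)) (total-solutions n _) (total-solutions n _) ⟩
  proportion (suc n) P                                 ∎
  where
  open ≡-Reasoning
  l = solutions n (P ∘ (false ∷_))
  r = solutions n (P ∘ (true ∷_))

proportion-cong : ∀ n {P Q} → (∀ σ → length σ ≡ n → P σ ≡ Q σ) → proportion n P ≡ proportion n Q
proportion-cong zero    P≗Q = cong (if_then 1ℚ else 0ℚ) (P≗Q [] refl)
proportion-cong (suc n) P≗Q = cong₂ (λ p q → ½ * (p + q))
  (proportion-cong n (λ σ len → P≗Q (false ∷ σ) (cong suc len)))
  (proportion-cong n (λ σ len → P≗Q (true ∷ σ) (cong suc len)))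

proportion-true : ∀ n → proportion n (λ _ → true) ≡ 1ℚ
proportion-true zero    = refl
proportion-true (suc n) rewrite proportion-true n = refl

proportion-split : ∀ n (P Q : String → Bool) →
  proportion n (λ σ → P σ ∧ Q σ) + proportion n (λ σ → P σ ∧ not (Q σ)) ≡ proportion n P
proportion-split zero P Q with P [] | Q []
... | true  | true  = refl
... | true  | false = refl
... | false | _     = refl
proportion-split (suc n) P Q = trans
  (solve 4 (λ a b c d → con ½ :* (a :+ b) :+ con ½ :* (c :+ d) := con ½ :* ((a :+ c) :+ (b :+ d))) refl
    (proportion n _) (proportion n _) (proportion n _) (proportion n _))
  (cong₂ (λ p q → ½ * (p + q)) (proportion-split n (P ∘ (false ∷_)) (Q ∘ (false ∷_)))
    (proportion-split n (P ∘ (true ∷_)) (Q ∘ (true ∷_))))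

flip : ℕ → String → String
flip _       []      = []
flip zero    (b ∷ σ) = not b ∷ σ
flip (suc j) (b ∷ σ) = b ∷ flip j σ

-- Flipping the first bit swaps the two halves; flipping a later one acts inside each half.
proportion-flip : ∀ j n P → proportion n (P ∘ flip j) ≡ proportion n P
proportion-flip j       zero    P = refl
proportion-flip zero    (suc n) P = cong (½ *_) (ℚ.+-comm (proportion n (P ∘ (true ∷_))) (proportion n (P ∘ (false ∷_))))
proportion-flip (suc j) (suc n) P = cong₂ (λ p q → ½ * (p + q))
  (proportion-flip j n (P ∘ (false ∷_))) (proportion-flip j n (P ∘ (true ∷_)))

-- Flipping bit j maps the strings with P ∧ Q onto those with P ∧ ¬ Q.
proportion-half : ∀ j n {P Q} →
  (∀ σ → length σ ≡ n → P (flip j σ) ≡ P σ) → (∀ σ → length σ ≡ n → Q (flip j σ) ≡ not (Q σ)) →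
  proportion n (λ σ → P σ ∧ Q σ) ≡ ½ * proportion n P
proportion-half j n {P} {Q} P-flip Q-flip = begin
  p                    ≡⟨ halves p ⟨
  ½ * p + ½ * p        ≡⟨ ℚ.*-distribˡ-+ ½ p p ⟨
  ½ * (p + p)          ≡⟨ cong (λ q → ½ * (p + q)) flipped ⟩
  ½ * (p + proportion n (λ σ → P σ ∧ not (Q σ))) ≡⟨ cong (½ *_) (proportion-split n P Q) ⟩
  ½ * proportion n P   ∎
  where
  open ≡-Reasoning
  p = proportion n (λ σ → P σ ∧ Q σ)
  flipped : p ≡ proportion n (λ σ → P σ ∧ not (Q σ))
  flipped = trans (sym (proportion-flip j n (λ σ → P σ ∧ Q σ)))
    (proportion-cong n λ σ len → cong₂ _∧_ (P-flip σ len) (Q-flip σ len))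

-- false past the end of the string
at : ℕ → String → Bool
at _       []      = false
at zero    (b ∷ σ) = b
at (suc j) (b ∷ σ) = at j σ

at-flip : ∀ j σ → j ℕ.< length σ → at j (flip j σ) ≡ not (at j σ)
at-flip zero    (b ∷ σ) _         = refl
at-flip (suc j) (b ∷ σ) (s≤s j<n) = at-flip j σ j<n

at-flip-≢ : ∀ i j σ → i ≢ j → at i (flip j σ) ≡ at i σ
at-flip-≢ i       j       []      _   = refl
at-flip-≢ zero    zero    (b ∷ σ) i≢j = contradiction refl i≢j
at-flip-≢ zero    (suc j) (b ∷ σ) _   = refl
at-flip-≢ (suc i) zero    (b ∷ σ) _   = refl
at-flip-≢ (suc i) (suc j) (b ∷ σ) i≢j = at-flip-≢ i j σ (i≢j ∘ cong suc)

at-prefix : ∀ {j n} X → j ℕ.< n → at j (prefix n X) ≡ X j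
at-prefix {zero}  X (s≤s _)   = refl
at-prefix {suc j} X (s≤s j<n) = at-prefix (X ∘ suc) j<n

agree : Bool → Bool → Bool
agree a b = not (a xor b)

agree-not : ∀ a b → agree (not a) b ≡ not (agree a b)
agree-not false false = refl
agree-not false true  = refl
agree-not true  false = refl
agree-not true  true  = refl

agree-self : ∀ a → agree a a ≡ true
agree-self false = refl
agree-self true  = refl

-- The measure of the first n constraints

module Cover (k : ℕ → ℕ) (offset : ℕ → ℕ) where

  open Constraints k offset

  -- The Boolean counterpart of `violations`: that one works on codes and serves computability, this
  -- one works on strings and serves the measure. The two can differ on strings that are too short,
  -- since `at` has a default value.
  satisfies : ℕ → String → Bool
  satisfies zero    σ = true
  satisfies (suc i) σ = satisfies i σ ∧ agree (at (point i) σ) (at (k (point i)) σ)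

  -- The first i constraints read only positions below `bound i`.
  satisfies-flip : ∀ i {j} σ → bound i ℕ.≤ j → satisfies i (flip j σ) ≡ satisfies i σ
  satisfies-flip zero    σ _ = refl
  satisfies-flip (suc i) {j} σ b≤j = cong₂ _∧_
    (satisfies-flip i σ (ℕ.≤-trans (bound-mono (ℕ.n≤1+n i)) b≤j))
    (cong₂ agree (at-flip-≢ (point i) j σ (ℕ.<⇒≢ (ℕ.<-≤-trans (point<bound i) b≤j)))
                 (at-flip-≢ (k (point i)) j σ (ℕ.<⇒≢ (ℕ.<-≤-trans (image<bound i) b≤j))))

  satisfies-prefix : ∀ n {L} X → (∀ i → i ℕ.< n → X (point i) ≡ X (k (point i))) →
    bound n ℕ.≤ L → satisfies n (prefix L X) ≡ true
  satisfies-prefix zero    X same b≤L = refl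
  satisfies-prefix (suc n) X same b≤L
    rewrite satisfies-prefix n X (λ i i<n → same i (ℕ.m≤n⇒m≤1+n i<n)) (ℕ.≤-trans (bound-mono (ℕ.n≤1+n n)) b≤L)
          | at-prefix X (ℕ.<-≤-trans (point<bound n) b≤L)
          | at-prefix X (ℕ.<-≤-trans (image<bound n) b≤L)
          | same n ℕ.≤-refl = agree-self (X (k (point n)))

  -- point n lies above every position that the first n constraints mention.
  proportion-satisfies : (∀ m → k (next m) ≢ next m) → ∀ n {L} → bound n ℕ.≤ L →
    proportion L (satisfies n) ≡ ½ ^ n
  proportion-satisfies moved zero    {L} b≤L = proportion-true L
  proportion-satisfies moved (suc n) {L} b≤L = trans
    (proportion-half (point n) L
      (λ σ _ → satisfies-flip n σ (bound≤point n))
      (λ σ len → trans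
        (cong₂ agree (at-flip (point n) σ (subst (point n ℕ.<_) (sym len) (ℕ.<-≤-trans (point<bound n) b≤L)))
                     (at-flip-≢ (k (point n)) (point n) σ (moved (bound n))))
        (agree-not (at (point n) σ) _)))
    (cong (½ *_) (proportion-satisfies moved n (ℕ.≤-trans (bound-mono (ℕ.n≤1+n n)) b≤L)))

  cover : ℕ → List String
  cover n = solutions (bound n) (satisfies n)

  total-cover : (∀ m → k (next m) ≢ next m) → ∀ n → total (cover n) ≡ ½ ^ n
  total-cover moved n = trans (total-solutions (bound n) (satisfies n))
    (proportion-satisfies moved n ℕ.≤-refl)

  cover-covers : ∀ n X → (∀ i → i ℕ.< n → X (point i) ≡ X (k (point i))) → ∃[ σ ] σ ∈ cover n × [ σ ] X
  cover-covers n X same = prefix (bound n) X ,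
    ∈-solutions (bound n) (satisfies n) X (satisfies-prefix n X same ℕ.≤-refl) , prefix-∈ (bound n) X

-- Enumeration of the programs

vectors : ∀ {A : Set} m → List A → List (Vec A m)
vectors zero    l = [] ∷ []
vectors (suc m) l = cartesianProductWith _∷_ l (vectors m l)

∈-vectors : ∀ {A : Set} {m l} {v : Vec A m} → All (_∈ l) v → v ∈ vectors m l
∈-vectors []           = here refl
∈-vectors (a∈l ∷ v⊆l) = ∈-cartesianProductWith⁺ _∷_ a∈l (∈-vectors v⊆l)

sucs : ∀ n → List (Rec n)
sucs 1 = sucᶜ ∷ []
sucs _ = []

precs : (∀ n → List (Rec n)) → ∀ n → List (Rec n)
precs R zero    = []
precs R (suc n) = cartesianProductWith prec (R n) (R (suc (suc n)))

compositions : (∀ n → List (Rec n)) → ∀ n → ℕ → List (Rec n)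
compositions R n m = cartesianProductWith comp (R m) (vectors m (R n))

-- Keeping `R n` makes the stages increase. The intermediate arity of a composition is restricted to
-- numbers below d, which keeps each stage finite.
extend : ℕ → (∀ n → List (Rec n)) → ∀ n → List (List (Rec n))
extend d R n = R n ∷ (zeroᶜ ∷ []) ∷ map proj (allFin n) ∷ sucs n ∷
  concat (map (compositions R n) (upTo d)) ∷ precs R n ∷ map mu (R (suc n)) ∷ []

programs : ℕ → ∀ n → List (Rec n)
programs zero    n = []
programs (suc d) n = concat (extend d (programs d) n)

∈-programs : ∀ d {n l} {f : Rec n} → f ∈ l → l ∈ extend d (programs d) n → f ∈ programs (suc d) n
∈-programs d = ∈-concat⁺′

programs-mono : ∀ {d d′ n} {f : Rec n} → d ℕ.≤ d′ → f ∈ programs d n → f ∈ programs d′ n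
programs-mono {d′ = zero} z≤n ()
programs-mono {d′ = suc d′} d≤1+d′ f∈ with ℕ.m≤n⇒m<n∨m≡n d≤1+d′
... | inj₂ refl       = f∈
... | inj₁ (s≤s d≤d′) = ∈-programs d′ (programs-mono d≤d′ f∈) (here refl)

programs-complete : ∀ {n} (f : Rec n) → ∃[ d ] f ∈ programs d n
programs-complete* : ∀ {m n} (gs : Vec (Rec n) m) → ∃[ d ] All (_∈ programs d n) gs

programs-complete zeroᶜ    = 1 , ∈-programs 0 (here refl) (there (here refl))
programs-complete sucᶜ     = 1 , ∈-programs 0 {l = sucs 1} (here refl) (there (there (there (here refl))))
programs-complete (proj i) = 1 , ∈-programs 0 (∈-map⁺ proj (∈-allFin i)) (there (there (here refl)))
programs-complete {n} (comp {m} f gs)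
  with d , f∈ ← programs-complete f | d′ , gs∈ ← programs-complete* gs =
  suc e , ∈-programs e
    (∈-concat⁺′ (∈-cartesianProductWith⁺ comp
        (programs-mono (ℕ.≤-trans (ℕ.m≤m⊔n d d′) d⊔d′≤e) f∈)
        (∈-vectors (All.map (programs-mono (ℕ.≤-trans (ℕ.m≤n⊔m d d′) d⊔d′≤e)) gs∈)))
      (∈-map⁺ (compositions (programs e) n) (∈-upTo⁺ (ℕ.m≤m⊔n (suc m) (d ℕ.⊔ d′)))))
    (there (there (there (there (here refl)))))
  where
  -- Stage e has to contain `f` and `gs` and also admit the arity m; as `upTo e` stops below e, this
  -- takes `suc m`.
  e = suc m ℕ.⊔ (d ℕ.⊔ d′)
  d⊔d′≤e = ℕ.m≤n⊔m (suc m) (d ℕ.⊔ d′)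
programs-complete (prec f g)
  with d , f∈ ← programs-complete f | d′ , g∈ ← programs-complete g =
  suc (d ℕ.⊔ d′) , ∈-programs (d ℕ.⊔ d′)
    (∈-cartesianProductWith⁺ prec (programs-mono (ℕ.m≤m⊔n d d′) f∈) (programs-mono (ℕ.m≤n⊔m d d′) g∈))
    (there (there (there (there (there (here refl))))))
programs-complete (mu f) with d , f∈ ← programs-complete f =
  suc d , ∈-programs d (∈-map⁺ mu f∈) (there (there (there (there (there (there (here refl)))))))

programs-complete* []       = 0 , []
programs-complete* (g ∷ gs)
  with d , g∈ ← programs-complete g | d′ , gs∈ ← programs-complete* gs =
  d ℕ.⊔ d′ , programs-mono (ℕ.m≤m⊔n d d′) g∈ ∷ All.map (programs-mono (ℕ.m≤n⊔m d d′)) gs∈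

-- Small powers of ½

-- The first list takes at most half of `½ ^ N`; the remaining ones satisfy the hypothesis for N + 1
-- and share the other half.
totals-geometric : ∀ {L} N → (∀ e → total (L e) ≤ ½ ^ suc (e ℕ.+ N)) → ∀ n → totals L n ≤ ½ ^ N
totals-geometric N L≤ zero = ½^n≥0 N
totals-geometric {L} N L≤ (suc n) = subst (total (L 0) + totals (L ∘ suc) n ≤_) (halves (½ ^ N))
  (ℚ.+-mono-≤ (L≤ 0) (totals-geometric (suc N)
    (λ e → subst (λ m → total (L (suc e)) ≤ ½ ^ suc m) (sym (ℕ.+-suc e N)) (L≤ (suc e))) n))

fromℕ : ℕ → ℚ
fromℕ zero    = 0ℚ
fromℕ (suc n) = 1ℚ + fromℕ n

-- This is n ≤ 2^n in divided form: the step averages the bounds for `½ ^ n` and for n times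
-- `½ ^ n`.
n½^n≤1 : ∀ n → fromℕ n * ½ ^ n ≤ 1ℚ
n½^n≤1 zero    = ℚ.nonNegative⁻¹ 1ℚ
n½^n≤1 (suc n) = begin
  (1ℚ + fromℕ n) * (½ * ½ ^ n)          ≡⟨ solve 2
    (λ m p → (con 1ℚ :+ m) :* (con ½ :* p) := con ½ :* p :+ con ½ :* (m :* p)) refl (fromℕ n) (½ ^ n) ⟩
  ½ * ½ ^ n + ½ * (fromℕ n * ½ ^ n)     ≤⟨ ℚ.+-mono-≤ (ℚ.*-monoˡ-≤-nonNeg ½ (½^n≤1 n)) (ℚ.*-monoˡ-≤-nonNeg ½ (n½^n≤1 n)) ⟩
  ½ * 1ℚ + ½ * 1ℚ                       ∎
  where
  open ℚ.≤-Reasoning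
  ½^n≤1 : ∀ n → ½ ^ n ≤ 1ℚ
  ½^n≤1 zero    = ℚ.≤-refl
  ½^n≤1 (suc n) = ℚ.≤-trans (ℚ.*-monoˡ-≤-nonNeg ½ (½^n≤1 n)) (p≤p+q ½ (ℚ.nonNegative⁻¹ ½))

toℚᵘ-fromℕ : ∀ n → toℚᵘ (fromℕ n) ℚᵘ.≃ mkℚᵘ (ℤ.+ n) 0
toℚᵘ-fromℕ zero    = *≡* refl
toℚᵘ-fromℕ (suc n) = ℚᵘ.≃-trans (ℚ.toℚᵘ-homo-+ 1ℚ (fromℕ n))
  (ℚᵘ.≃-trans (ℚᵘ.+-congʳ ℚᵘ.1ℚᵘ (toℚᵘ-fromℕ n))
    (*≡* (cong (λ m → (ℤ.+ 1 ℤ.+ m) ℤ.* ℤ.+ 1) (ℤ.*-identityʳ (ℤ.+ n)))))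

-- The product is the numerator of p, a positive integer.
1≤p*denominator : ∀ p → 0ℚ < p → 1ℚ ≤ p * fromℕ (↧ₙ p)
1≤p*denominator p@(mkℚ (ℤ.+ suc a) d _) _ = ℚ.toℚᵘ-cancel-≤ (begin
  ℚᵘ.1ℚᵘ                          ≤⟨ *≤* (ℤ.+≤+ (ℕ.≤-trans (ℕ.≤-reflexive (cong suc (ℕ.+-identityʳ (d ℕ.* 1))))
                                       (ℕ.*-monoˡ-≤ 1 (ℕ.m≤n*m (suc d) (suc a))))) ⟩
  toℚᵘ p ℚᵘ.* mkℚᵘ (ℤ.+ suc d) 0  ≃⟨ ℚᵘ.*-congˡ {toℚᵘ p} (toℚᵘ-fromℕ (suc d)) ⟨
  toℚᵘ p ℚᵘ.* toℚᵘ (fromℕ (suc d)) ≃⟨ ℚ.toℚᵘ-homo-* p (fromℕ (suc d)) ⟨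
  toℚᵘ (p * fromℕ (suc d))        ∎)
  where open ℚᵘ.≤-Reasoning
1≤p*denominator (mkℚ (ℤ.+ zero)  _ _) (*<* (ℤ.+<+ ()))
1≤p*denominator (mkℚ ℤ.-[1+ _ ] _ _) (*<* ())

½^n-small : ∀ ε → 0ℚ < ε → ∃[ n ] ½ ^ n ≤ ε
½^n-small ε 0<ε = n , (begin
  ½ ^ n                  ≡⟨ ℚ.*-identityˡ (½ ^ n) ⟨
  1ℚ * ½ ^ n             ≤⟨ ℚ.*-monoʳ-≤-nonNeg (½ ^ n) {{½^n-nonNeg}} (1≤p*denominator ε 0<ε) ⟩
  (ε * fromℕ n) * ½ ^ n  ≡⟨ ℚ.*-assoc ε (fromℕ n) (½ ^ n) ⟩
  ε * (fromℕ n * ½ ^ n)  ≤⟨ ℚ.*-monoˡ-≤-nonNeg ε {{nonNegative (ℚ.<⇒≤ 0<ε)}} (n½^n≤1 n) ⟩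
  ε * 1ℚ                 ≡⟨ ℚ.*-identityʳ ε ⟩
  ε                      ∎)
  where
  open ℚ.≤-Reasoning
  -- With n the denominator, ε is at least 1/n, and 1/n is at least `½ ^ n`.
  n = ↧ₙ ε
  ½^n-nonNeg = nonNegative (½^n≥0 n)

-- Non-rigid sets

autoreduction-invariant : ∀ {A k} → IsMAutoreduction A k → ∀ x → A x ≡ A (k x)
autoreduction-invariant {A} {k} (_ , equiv) x with A x in Ax | A (k x) in Akx
... | true  | true  = refl
... | false | false = refl
... | true  | false = trans (sym (Equivalence.to (equiv x) Ax)) Akx
... | false | true  = trans (sym Ax) (Equivalence.from (equiv x) Akx)

module _ (em : ExcludedMiddle 0ℓ) where

  module Displaced {k : ℕ → ℕ} (¬id : ¬ EventuallyIdentity k) where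

    offset : ℕ → ℕ
    offset m = proj₁ (leastMoved em k ¬id m)

    offset-least : ∀ m → IsLeastMoved k m (offset m)
    offset-least m = proj₂ (leastMoved em k ¬id m)

    open Constraints k offset public
    open Cover k offset public

    cover-total : ∀ n → total (cover n) ≡ ½ ^ n
    cover-total = total-cover (proj₁ ∘ offset-least)

    test : ℕ → Pred String 0ℓ
    test n σ = violations n (code σ) ≡ 0

    test-isMartinLöf : Computable k → IsMartinLöfTest test
    test-isMartinLöf k-computable = record
      -- `offset` was chosen by excluded middle, but its values are least solutions, so a search
      -- recovers them effectively.
      { uniformlyCE = zeroSet-uniformlyCE
          (violations-computable k-computable (offset-computable k-computable offset-least))
      -- The strings in `test n` have unbounded length and overlap. The bound comes from the finite
      -- list `cover n`, which contains the prefix of length `bound n` of every X obeying the first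
      -- n constraints.
      ; measure≤ = λ n → finite-cover (cover n) (ℚ.≤-reflexive (cover-total n))
          λ { {X} (σ , σ∈test , X∈σ) → cover-covers n X (violations-code≡0 n σ {X} X∈σ σ∈test) }
      }

    test-captures : ∀ {A} → IsMAutoreduction A k → ∀ n → ⟦ test n ⟧ A
    test-captures {A} auto n = prefix (bound n) A ,
      violations-prefix≡0 n A (λ i _ → autoreduction-invariant auto (point i)) ℕ.≤-refl ,
      prefix-∈ (bound n) A

  random⇒rigid : ∀ A → MartinLöfRandom A → MRigid A
  random⇒rigid A random k auto = decidable-stable em λ ¬id →
    let open Displaced ¬id in random test (test-isMartinLöf (proj₁ auto)) (test-captures auto)

  -- The non-rigid sets form a null class

  program : ℕ → Maybe (Rec 1)
  program = flatten (λ d → programs d 1)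

  Displacing : Rec 1 → Set
  Displacing f = ∃[ k ] (∀ x → f ⟨ x ∷ [] ⟩⇓ k x) × ¬ EventuallyIdentity k

  -- Excluded middle decides whether the program computes a total function that is not eventually
  -- the identity; all other programs get the empty cover.
  fixedCover : ℕ → Maybe (Rec 1) → List String
  fixedCover n nothing = []
  fixedCover n (just f) with em {Displacing f}
  ... | yes (_ , _ , ¬id) = Displaced.cover ¬id n
  ... | no _              = []

  total-fixedCover : ∀ n f → total (fixedCover n f) ≤ ½ ^ n
  total-fixedCover n nothing = ½^n≥0 n
  total-fixedCover n (just f) with em {Displacing f}
  ... | yes (_ , _ , ¬id) = ℚ.≤-reflexive (Displaced.cover-total ¬id n)
  ... | no _              = ½^n≥0 n

  fixedCover-covers : ∀ n f {X k} → (∀ x → f ⟨ x ∷ [] ⟩⇓ k x) → IsMAutoreduction X k →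
    ¬ EventuallyIdentity k → ∃[ σ ] σ ∈ fixedCover n (just f) × [ σ ] X
  fixedCover-covers n f {X} {k} f⇓ auto ¬id with em {Displacing f}
  ... | no none = contradiction (k , f⇓ , ¬id) none
  -- The cover was built from the `k′` supplied by excluded middle. Since `f` computes both `k` and
  -- `k′`, they agree at every point.
  ... | yes (k′ , f⇓′ , ¬id′) = cover-covers n X λ i _ →
      trans (autoreduction-invariant auto (point i)) (cong X (⇓-functional (f⇓ (point i)) (f⇓′ (point i))))
    where open Displaced ¬id′

  nonrigid-witness : ∀ {X} → ¬ MRigid X → ∃[ k ] IsMAutoreduction X k × ¬ EventuallyIdentity k
  nonrigid-witness ¬rigid = decidable-stable em λ none →
    ¬rigid λ k auto → decidable-stable em λ ¬id → none (k , auto , ¬id)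

  nonrigid-null : OuterMeasure≤ (∁ MRigid) 0ℚ
  nonrigid-null ε 0<ε =
    flatten covers ,
    flatten-covers {covers} {∁ MRigid} covered ,
    flatten-total {covers} λ n → subst (totals covers n ≤_) (sym (ℚ.+-identityˡ ε))
      (ℚ.≤-trans (totals-geometric {covers} N (λ e → total-fixedCover (suc (e ℕ.+ N)) (program e)) n)
        (proj₂ (½^n-small ε 0<ε)))
    where
    N = proj₁ (½^n-small ε 0<ε)
    covers : ℕ → List String
    -- The e-th program receives at most `½ ^ suc (e + N)`; these amounts add up to at most `½ ^ N`,
    -- which N makes at most ε.
    covers e = fixedCover (suc (e ℕ.+ N)) (program e)
    covered : ∀ {X} → ¬ MRigid X → ∃[ e ] ∃[ σ ] σ ∈ covers e × [ σ ] X
    covered {X} ¬rigid =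
      let k , auto , ¬id = nonrigid-witness ¬rigid
          f , f⇓ = proj₁ auto
          d , f∈ = programs-complete f
          e , eq = flatten-surjective (λ d → programs d 1) d f∈
      in e , subst (λ p → ∃[ σ ] σ ∈ fixedCover (suc (e ℕ.+ N)) p × [ σ ] X) (sym eq)
               (fixedCover-covers (suc (e ℕ.+ N)) f f⇓ auto ¬id)

proposition4p1 : ExcludedMiddle 0ℓ →
    HasMeasure MRigid 1ℚ × (∀ A → MartinLöfRandom A → MRigid A)
proposition4p1 em = conull em (nonrigid-null em) , random⇒rigid em
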